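{- For every fixed integer $R\ge 0$, $K^+(n,R)\in\Theta(2^n/n^R)$ as $n\to\infty$; that is, there are constants $c_R,C_R>0$ (depending only on $R$) and $n_0$ such that $c_R\,2^n/n^R\le K^+(n,R)\le C_R\,2^n/n^R$ for all integers $n\ge n_0$.
   Context: $Q_n=\{0,1\}^n$ is ordered by $x\preceq y$ iff $x_i\le y_i$ for all $i$, and $d(x,y)$ is the Hamming distance. The downward directed ball is $B_n^-(x,R)=\{y\in Q_n: y\preceq x,\ d(x,y)\le R\}$. A set $\mathcal{C}\subseteq Q_n$ downward $R$-covers $Q_n$ if $Q_n=\bigcup_{c\in\mathcal{C}}B_n^-(c,R)$. $K^+(n,R)$ denotes the minimum size of a set $\mathcal{C}\subseteq Q_n$ that downward $R$-covers $Q_n$ (in particular $K^+(n,R)=1$ for $R\ge n$). -}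

module Defs where

open import Data.Bool using (Bool; true; false)
import Data.Bool as Bool
import Data.Bool.Properties as Bool
open import Data.Integer using (+_)
open import Data.List using (List; []; _∷_; length; cartesianProductWith; deduplicate)
open import Data.List.Membership.Propositional using (_∈_; lose; find)
open import Data.List.Membership.Propositional.Properties
  using (∈-cartesianProductWith⁺; ∈-deduplicate⁺)
open import Data.List.Relation.Unary.All as All using (all?)
open import Data.List.Relation.Unary.Any using (Any; any?; here; there)
open import Data.List.Relation.Unary.Unique.Propositional using (Unique)
import Data.List.Relation.Unary.Unique.DecPropositional as DecUnique
open import Data.List.Relation.Unary.Unique.DecPropositional.Properties using (deduplicate-!)
open import Data.Nat using (ℕ; zero; suc; _≤_; _≤?_; _^_; z≤n; s≤s; NonZero)
open import Data.Nat.Properties using (m^n≢0)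
open import Data.Product using (∃-syntax; _×_; _,_; proj₁; proj₂; uncurry)
open import Data.Rational using (ℚ; _/_)
open import Data.Vec as Vec using (Vec; []; _∷_; toList; fromList; count; zip)
open import Data.Vec.Properties using (≡-dec; length-toList; toList∘fromList)
open import Data.Vec.Relation.Binary.Pointwise.Inductive as Pointwise using (Pointwise)
open import Function using (_∘_)
open import Level using (0ℓ)
open import Relation.Binary.Definitions using (DecidableEquality)
open import Relation.Binary.PropositionalEquality using (_≡_; refl; sym; subst)
open import Relation.Nullary using (yes; no; ¬?; contradiction)
open import Relation.Nullary.Decidable using (map′; _×-dec_)
open import Relation.Unary using (Pred; Decidable)
import Relation.Unary as Unary

Q : ℕ → Set
Q n = Vec Bool n

infix 4 _≼_

-- Data.Bool._≤_ is the order false ≤ true.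
_≼_ : ∀ {n} → Q n → Q n → Set
_≼_ = Pointwise Bool._≤_

d : ∀ {n} → Q n → Q n → ℕ
d x y = count (λ p → ¬? (uncurry Bool._≟_ p)) (zip x y)

B⁻ : ∀ {n} → Q n → ℕ → Pred (Q n) 0ℓ
B⁻ x R y = y ≼ x × d x y ≤ R

DownwardCovers : ∀ {n} → ℕ → List (Q n) → Set
DownwardCovers R C = ∀ y → Any (λ c → y Unary.∈ B⁻ c R) C

-- Subsets of Q n are duplicate-free lists, so that length is cardinality.
HasCoverOfSize : ℕ → ℕ → ℕ → Set
HasCoverOfSize n R k =
  ∃[ C ] Unique C × length C ≡ k × DownwardCovers {n} R C

IsLeast : Pred ℕ 0ℓ → Pred ℕ 0ℓ
IsLeast P k = P k × (∀ j → P j → k ≤ j)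

least : {P : Pred ℕ 0ℓ} → Decidable P → ∃[ m ] P m → ∃[ k ] IsLeast P k
least P? (m , pm) = search P? m pm
  where
  search : {P : Pred ℕ 0ℓ} → Decidable P → ∀ m → P m → ∃[ k ] IsLeast P k
  search P? m pm with P? 0
  search P? m       pm | yes p₀ = 0 , p₀ , λ _ _ → z≤n
  search P? zero    pm | no ¬p₀ = contradiction pm ¬p₀
  search P? (suc m) pm | no ¬p₀ with search (P? ∘ suc) m pm
  ... | k , pk , k-min = suc k , pk , λ where
    zero    p₀ → contradiction p₀ ¬p₀
    (suc j) pj → s≤s (k-min j pj)

module _ {A : Set} where

  allVecs : List A → ∀ k → List (Vec A k)
  allVecs xs zero    = [] ∷ []
  allVecs xs (suc k) = cartesianProductWith _∷_ xs (allVecs xs k)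

  ∈-allVecs : ∀ {xs} → (∀ x → x ∈ xs) → ∀ {k} (v : Vec A k) → v ∈ allVecs xs k
  ∈-allVecs all []      = here refl
  ∈-allVecs all (x ∷ v) = ∈-cartesianProductWith⁺ _∷_ (all x) (∈-allVecs all v)

allQ : ∀ n → List (Q n)
allQ = allVecs (false ∷ true ∷ [])

∈-allQ : ∀ {n} (x : Q n) → x ∈ allQ n
∈-allQ = ∈-allVecs λ where
  false → here refl
  true  → there (here refl)

_≟Q_ : ∀ {n} → DecidableEquality (Q n)
_≟Q_ = ≡-dec Bool._≟_

B⁻? : ∀ {n} (x : Q n) R → Decidable (B⁻ x R)
B⁻? x R y = Pointwise.decidable Bool._≤?_ y x ×-dec (d x y ≤? R)

downwardCovers? : ∀ {n} R → Decidable (DownwardCovers {n} R)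
downwardCovers? {n} R C =
  map′ (λ all y → All.lookup all (∈-allQ y)) (λ cov → All.tabulate (λ {y} _ → cov y))
       (all? (λ y → any? (λ c → B⁻? c R y) C) (allQ n))

hasCoverOfSize? : ∀ n R → Decidable (HasCoverOfSize n R)
hasCoverOfSize? n R k = map′ to from (any? P? (allVecs (allQ n) k))
  where
  P : Pred (Vec (Q n) k) 0ℓ
  P v = Unique (toList v) × DownwardCovers R (toList v)

  P? : Decidable P
  P? v = DecUnique.unique? _≟Q_ (toList v) ×-dec downwardCovers? R (toList v)

  to : Any P (allVecs (allQ n) k) → HasCoverOfSize n R k
  to any with find any
  ... | v , _ , u , cov = toList v , u , length-toList v , cov

  from : HasCoverOfSize n R k → Any P (allVecs (allQ n) k)
  from (C , u , refl , cov) = lose (∈-allVecs ∈-allQ (fromList C))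
    (subst (λ D → Unique D × DownwardCovers R D) (sym (toList∘fromList C)) (u , cov))

d-refl : ∀ {n} (x : Q n) → d x x ≡ 0
d-refl []          = refl
d-refl (false ∷ x) = d-refl x
d-refl (true  ∷ x) = d-refl x

x∈B⁻ : ∀ {n} (x : Q n) R → x Unary.∈ B⁻ x R
x∈B⁻ x R = Pointwise.refl Bool.≤-refl , subst (_≤ R) (sym (d-refl x)) z≤n

coverExists : ∀ n R → ∃[ k ] HasCoverOfSize n R k
coverExists n R = _ , deduplicate _≟Q_ (allQ n) , deduplicate-! _≟Q_ (allQ n) , refl ,
  λ y → lose (∈-deduplicate⁺ _≟Q_ (∈-allQ y)) (x∈B⁻ y R)

K⁺ : ℕ → ℕ → ℕ
K⁺ n R = proj₁ (least (hasCoverOfSize? n R) (coverExists n R))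

K⁺-isLeast : ∀ n R → IsLeast (HasCoverOfSize n R) (K⁺ n R)
K⁺-isLeast n R = proj₂ (least (hasCoverOfSize? n R) (coverExists n R))

-- 2ⁿ / nᴿ; n must be nonzero because nᴿ = 0 when n = 0 and R > 0.
2ⁿ/nᴿ : (n R : ℕ) .{{_ : NonZero n}} → ℚ
2ⁿ/nᴿ n R = (+ (2 ^ n) / (n ^ R)) {{m^n≢0 n R}}

fromℕ : ℕ → ℚ
fromℕ k = + k / 1

{-# OPTIONS --safe #-}
module Submission where

-- Lower bound: a downward ball has at most (n + 1)ᴿ points.
--
-- Upper bound: direct sums multiply densities and add radii, so it suffices to cover cubes of
-- dimension n = O(2ʳ) with radius 1 and density O(2⁻ʳ). Label the coordinates of Q m, m = 2ʳ,
-- by the elements of Q r and let f(u) be the sum of the labels of the ones of u. The code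
-- {(u, f(u))} has density 1/m in Q (m + r), and it misses (u, v) only if the coordinate labelled
-- f(u) + v is already 1 in u, which holds for half of all (u, v). On a further factor Q n only
-- this half needs a covering of Q n. So if Q n has a covering of density κ, then Q (m + r + n)
-- has one of density 1/m + κ/2, and κ ≤ 3/2ʳ can be propagated along r at bounded cost.

open import Defs
open import Data.Bool using (true; false; _xor_; f≤t)
import Data.Bool.Properties as Bool
open import Data.Fin using (Fin; zero; suc)
import Data.Fin.Properties as Fin
import Data.Integer as ℤ
import Data.Integer.Properties as ℤ
open import Data.List as List
  using (List; []; _∷_; length; map; _++_; allFin; cartesianProductWith; deduplicate)
open import Data.List.Membership.Propositional using (_∈_; find; lose)
open import Data.List.Membership.Propositional.Properties
  using (∈-++⁺ˡ; ∈-++⁺ʳ; ∈-map⁺; ∈-allFin; ∈-cartesianProductWith⁺; ∈-deduplicate⁺)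
open import Data.List.Properties using (length-++; length-map; length-tabulate; length-deduplicate)
open import Data.List.Relation.Unary.Any as Any using (here; index)
import Data.List.Relation.Unary.Any.Properties as Any
open import Data.List.Relation.Unary.Unique.DecPropositional.Properties using (deduplicate-!)
open import Data.Nat as ℕ using (ℕ; zero; suc; _^_; _≥_; z≤n; s≤s; NonZero)
import Data.Nat.Properties as ℕ
open import Data.Nat.Tactic.RingSolver using (solve-∀)
open import Data.Product using (∃-syntax; _×_; _,_; proj₂)
open import Data.Product.Function.NonDependent.Propositional using (_×-↔_)
import Data.Rational as ℚ
import Data.Rational.Properties as ℚ
import Data.Rational.Unnormalised as ℚᵘ
import Data.Rational.Unnormalised.Properties as ℚᵘ
open import Data.Vec as Vec using ([]; _∷_; lookup; _[_]≔_)
open import Data.Vec.Properties using (insertAt-removeAt; zipWith-assoc; zipWith-comm)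
open import Data.Vec.Relation.Binary.Pointwise.Inductive as Pointwise using ([]; _∷_)
open import Function using (_∘_; _$_; _↔_; mk↔ₛ′)
open import Function.Bundles using (module Injection)
open import Function.Properties.Inverse using (↔-trans; Inverse⇒Injection)
open import Relation.Binary.PropositionalEquality
  using (_≡_; refl; sym; trans; cong; cong₂; subst; subst₂; module ≡-Reasoning)
open import Relation.Nullary using (yes; no)
import Relation.Unary as Unary

module _ where

  open import Data.Nat using (_+_; _∸_; _*_; _≤_; _<_; _<?_)
  open import Data.Nat.Properties

  -- Counting the points of the cube

  length-cartesianProductWith : ∀ {A B C : Set} (f : A → B → C) xs ys →
    length (cartesianProductWith f xs ys) ≡ length xs * length ys
  length-cartesianProductWith f []       ys = refl
  length-cartesianProductWith f (x ∷ xs) ys =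
    trans (length-++ (map (f x) ys))
          (cong₂ _+_ (length-map (f x) ys) (length-cartesianProductWith f xs ys))

  length-allQ : ∀ n → length (allQ n) ≡ 2 ^ n
  length-allQ zero    = refl
  length-allQ (suc n) =
    trans (length-cartesianProductWith _∷_ (false ∷ true ∷ []) (allQ n)) (cong (2 *_) (length-allQ n))

  Fin↔Q : ∀ n → Fin (2 ^ n) ↔ Q n
  Fin↔Q zero    = mk↔ₛ′ (λ _ → []) (λ _ → zero) (λ { [] → refl }) (λ { zero → refl })
  Fin↔Q (suc n) = ↔-trans Fin.*↔× (↔-trans (Fin.2↔Bool ×-↔ Fin↔Q n)
    (mk↔ₛ′ (λ (b , x) → b ∷ x) Vec.uncons (λ { (_ ∷ _) → refl }) (λ _ → refl)))

  -- Pigeonhole: the position at which a point is found determines the point, so the points inject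
  -- into the positions of `xs`.
  enumeration⇒2ⁿ≤length : ∀ {n} (xs : List (Q n)) → (∀ y → y ∈ xs) → 2 ^ n ≤ length xs
  enumeration⇒2ⁿ≤length {n} xs y∈xs = Fin.injective⇒≤ (λ {i} {j} eq → toQ.injective (begin
    toQ.to i                                  ≡⟨ Any.lookup-index (y∈xs (toQ.to i)) ⟩
    List.lookup xs (index (y∈xs (toQ.to i)))  ≡⟨ cong (List.lookup xs) eq ⟩
    List.lookup xs (index (y∈xs (toQ.to j)))  ≡⟨ Any.lookup-index (y∈xs (toQ.to j)) ⟨
    toQ.to j                                  ∎))
    where
    open ≡-Reasoning
    module toQ = Injection (Inverse⇒Injection (Fin↔Q n))

  -- Volume of downward balls and the lower bound

  -- At a coordinate `false` the second list only repeats points. In exchange the length is the same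
  -- for all centres: it obeys Pascal's recursion and is the sum of the binomials `n` over `i` for
  -- `i ≤ R`.
  ball : ∀ {n} → ℕ → Q n → List (Q n)
  ball R       []      = [] ∷ []
  ball zero    (b ∷ x) = map (b ∷_) (ball zero x)
  ball (suc R) (b ∷ x) = map (b ∷_) (ball (suc R) x) ++ map (false ∷_) (ball R x)

  B⁻⊆ball : ∀ {n} R (x y : Q n) → y Unary.∈ B⁻ x R → y ∈ ball R x
  B⁻⊆ball R       []          []          _                  = here refl
  B⁻⊆ball zero    (false ∷ x) (false ∷ y) (_ ∷ y≼x , d≤)     =
    ∈-map⁺ _ (B⁻⊆ball zero x y (y≼x , d≤))
  B⁻⊆ball zero    (true ∷ x)  (true ∷ y)  (_ ∷ y≼x , d≤)     =
    ∈-map⁺ _ (B⁻⊆ball zero x y (y≼x , d≤))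
  B⁻⊆ball (suc R) (false ∷ x) (false ∷ y) (_ ∷ y≼x , d≤)     =
    ∈-++⁺ˡ (∈-map⁺ _ (B⁻⊆ball (suc R) x y (y≼x , d≤)))
  B⁻⊆ball (suc R) (true ∷ x)  (true ∷ y)  (_ ∷ y≼x , d≤)     =
    ∈-++⁺ˡ (∈-map⁺ _ (B⁻⊆ball (suc R) x y (y≼x , d≤)))
  B⁻⊆ball (suc R) (true ∷ x)  (false ∷ y) (_ ∷ y≼x , s≤s d≤) =
    ∈-++⁺ʳ (map (true ∷_) (ball (suc R) x)) (∈-map⁺ _ (B⁻⊆ball R x y (y≼x , d≤)))

  -- Pascal's recursion, together with `(n+1)^(R+1) + (n+1)^R = (n+2)(n+1)^R ≤ (n+2)^(R+1)`.
  length-ball : ∀ {n} R (x : Q n) → length (ball R x) ≤ suc n ^ R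
  length-ball R       []      = ≤-reflexive (sym (^-zeroˡ R))
  length-ball zero    (b ∷ x) = ≤-trans (≤-reflexive (length-map _ (ball zero x))) (length-ball zero x)
  length-ball {suc n} (suc R) (b ∷ x) = begin
    length (map (b ∷_) (ball (suc R) x) ++ map (false ∷_) (ball R x))
      ≡⟨ length-++ (map (b ∷_) (ball (suc R) x)) ⟩
    length (map (b ∷_) (ball (suc R) x)) + length (map (false ∷_) (ball R x))
      ≡⟨ cong₂ _+_ (length-map _ (ball (suc R) x)) (length-map _ (ball R x)) ⟩
    length (ball (suc R) x) + length (ball R x)
      ≤⟨ +-mono-≤ (length-ball (suc R) x) (length-ball R x) ⟩
    suc n * suc n ^ R + suc n ^ R      ≡⟨ +-comm (suc n * suc n ^ R) _ ⟩
    suc (suc n) * suc n ^ R            ≤⟨ *-monoʳ-≤ (suc (suc n)) (^-monoˡ-≤ R (n≤1+n (suc n))) ⟩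
    suc (suc n) * suc (suc n) ^ R      ∎
    where open ≤-Reasoning

  length-concatMap≤ : ∀ {A B : Set} (f : A → List B) b → (∀ x → length (f x) ≤ b) →
    ∀ xs → length (List.concatMap f xs) ≤ length xs * b
  length-concatMap≤ f b f≤b []       = z≤n
  length-concatMap≤ f b f≤b (x ∷ xs) = ≤-trans (≤-reflexive (length-++ (f x)))
    (+-mono-≤ (f≤b x) (length-concatMap≤ f b f≤b xs))

  -- The balls around the codewords of a minimum covering, concatenated, enumerate the whole cube.
  sphereCoveringBound : ∀ n R → 2 ^ n ≤ K⁺ n R * suc n ^ R
  sphereCoveringBound n R with K⁺ n R | K⁺-isLeast n R
  ... | _ | (C , _ , refl , cov) , _ = ≤-trans
    (enumeration⇒2ⁿ≤length (List.concatMap (ball R) C)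
      λ y → Any.concat⁺ (Any.map⁺ (Any.map (B⁻⊆ball R _ y) (cov y))))
    (length-concatMap≤ (ball R) _ (length-ball R) C)

  -- Covering densities

  -- The covering density is at most a / b; code may contain repetitions.
  record Density≤ (n R a b : ℕ) : Set where
    constructor density
    field
      code     : List (Q n)
      covers   : DownwardCovers R code
      length-≤ : b * length code ≤ a * 2 ^ n

  -- Removing repetitions makes the code a genuine set; it still covers and is no longer than
  -- before, so minimality applies.
  K⁺≤ : ∀ {n R a b} → Density≤ n R a b → b * K⁺ n R ≤ a * 2 ^ n
  K⁺≤ {n} {R} {a} {b} (density C cov C≤) = ≤-trans (*-monoʳ-≤ b (≤-trans
    (proj₂ (K⁺-isLeast n R) _ (deduplicate _≟Q_ C , deduplicate-! _≟Q_ C , refl , cov′))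
    (length-deduplicate _≟Q_ C))) C≤
    where
    cov′ : DownwardCovers R (deduplicate _≟Q_ C)
    cov′ y with find (cov y)
    ... | c , c∈C , y∈B = lose (∈-deduplicate⁺ _≟Q_ c∈C) y∈B

  -- Distances and balls under concatenation

  d-∷ : ∀ {n} b (x y : Q n) → d (b ∷ x) (b ∷ y) ≡ d x y
  d-∷ false x y = refl
  d-∷ true  x y = refl

  d-++ : ∀ {m n} (x x′ : Q m) (y y′ : Q n) → d (x Vec.++ y) (x′ Vec.++ y′) ≡ d x x′ + d y y′
  d-++ []          []           y y′ = refl
  d-++ (false ∷ x) (false ∷ x′) y y′ = d-++ x x′ y y′
  d-++ (false ∷ x) (true ∷ x′)  y y′ = cong suc (d-++ x x′ y y′)
  d-++ (true ∷ x)  (false ∷ x′) y y′ = cong suc (d-++ x x′ y y′)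
  d-++ (true ∷ x)  (true ∷ x′)  y y′ = d-++ x x′ y y′

  B⁻-++ : ∀ {m n R S} {x x′ : Q m} {y y′ : Q n} →
    x′ Unary.∈ B⁻ x R → y′ Unary.∈ B⁻ y S → (x′ Vec.++ y′) Unary.∈ B⁻ (x Vec.++ y) (R + S)
  B⁻-++ {x = x} {x′} {y} {y′} (x′≼x , dx) (y′≼y , dy) =
    Pointwise.++⁺ x′≼x y′≼y , ≤-trans (≤-reflexive (d-++ x x′ y y′)) (+-mono-≤ dx dy)

  raise-B⁻ : ∀ {n} (u : Q n) i → u Unary.∈ B⁻ (u [ i ]≔ true) 1
  raise-B⁻ (b ∷ u) (suc i) with raise-B⁻ u i
  ... | u≼ , d≤ = Bool.≤-refl ∷ u≼ , ≤-trans (≤-reflexive (d-∷ b (u [ i ]≔ true) u)) d≤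
  raise-B⁻ (false ∷ u) zero = f≤t ∷ Pointwise.refl Bool.≤-refl , ≤-reflexive (cong suc (d-refl u))
  raise-B⁻ (true ∷ u)  zero = Pointwise.refl Bool.≤-refl , ≤-trans (≤-reflexive (d-refl u)) z≤n

  *-interchange : ∀ w x y z → w * x * (y * z) ≡ w * y * (x * z)
  *-interchange = solve-∀

  -- Direct sums of coverings

  -- With radius 0 and density 1, this starts direct powers and pads a covering to a larger
  -- dimension without changing radius or density.
  trivialDensity : ∀ n → Density≤ n 0 1 1
  trivialDensity n = density (allQ n) (λ y → lose (∈-allQ y) (x∈B⁻ y 0)) $
    *-monoʳ-≤ 1 (≤-reflexive (length-allQ n))

  directSum : ∀ {m n R S a b a′ b′} →
    Density≤ m R a b → Density≤ n S a′ b′ → Density≤ (m + n) (R + S) (a * a′) (b * b′)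
  directSum {m} {n} {R} {S} {a} {b} {a′} {b′} (density C cov C≤) (density C′ cov′ C′≤) =
    density (cartesianProductWith Vec._++_ C C′) covers (begin
      b * b′ * length (cartesianProductWith Vec._++_ C C′)
        ≡⟨ cong (b * b′ *_) (length-cartesianProductWith Vec._++_ C C′) ⟩
      b * b′ * (length C * length C′)        ≡⟨ *-interchange b b′ _ _ ⟩
      b * length C * (b′ * length C′)        ≤⟨ *-mono-≤ C≤ C′≤ ⟩
      a * 2 ^ m * (a′ * 2 ^ n)               ≡⟨ *-interchange a _ a′ _ ⟩
      a * a′ * (2 ^ m * 2 ^ n)               ≡⟨ cong (a * a′ *_) (^-distribˡ-+-* 2 m n) ⟨
      a * a′ * 2 ^ (m + n)                   ∎)
    where
    open ≤-Reasoning
    covers : DownwardCovers (R + S) (cartesianProductWith Vec._++_ C C′)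
    covers y with Vec.splitAt m y
    ... | u , v , refl = Any.cartesianProductWith⁺ Vec._++_ B⁻-++ (cov u) (cov′ v)

  directPower : ∀ {n a b} R → Density≤ n 1 a b → Density≤ (R * n) R (a ^ R) (b ^ R)
  directPower zero    D = trivialDensity 0
  directPower (suc R) D = directSum D (directPower R D)

  -- Radius one

  infixl 6 _⊕_

  _⊕_ : ∀ {r} → Q r → Q r → Q r
  _⊕_ = Vec.zipWith _xor_

  ⊕-cancelˡ : ∀ {r} (x y : Q r) → x ⊕ (x ⊕ y) ≡ y
  ⊕-cancelˡ []          []      = refl
  ⊕-cancelˡ (false ∷ x) (c ∷ y) = cong (c ∷_) (⊕-cancelˡ x y)
  ⊕-cancelˡ (true ∷ x)  (c ∷ y) = cong₂ _∷_ (Bool.not-involutive c) (⊕-cancelˡ x y)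

  -- The parity-check matrix with columns `h i`, applied to `u` over the field with two elements.
  syndrome : ∀ {m r} → (Fin m → Q r) → Q m → Q r
  syndrome h []          = Vec.replicate _ false
  syndrome h (false ∷ u) = syndrome (h ∘ suc) u
  syndrome h (true ∷ u)  = h zero ⊕ syndrome (h ∘ suc) u

  syndrome-raise : ∀ {m r} (h : Fin m → Q r) u i → lookup u i ≡ false →
    syndrome h (u [ i ]≔ true) ≡ syndrome h u ⊕ h i
  syndrome-raise h (false ∷ u) zero    _  = zipWith-comm Bool.xor-comm (h zero) _
  syndrome-raise h (false ∷ u) (suc i) uᵢ = syndrome-raise (h ∘ suc) u i uᵢ
  syndrome-raise h (true ∷ u)  (suc i) uᵢ =
    trans (cong (h zero ⊕_) (syndrome-raise (h ∘ suc) u i uᵢ))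
          (sym (zipWith-assoc Bool.xor-assoc (h zero) _ _))

  -- The pairs `(i , u)` in which bit `i` of `u` is set. Inserting that bit into a shorter vector
  -- produces them without filtering, so that counting them is immediate.
  incidences : ∀ m → List (Fin m × Q m)
  incidences zero    = []
  incidences (suc m) =
    cartesianProductWith (λ i u → i , Vec.insertAt u i true) (allFin (suc m)) (allQ m)

  ∈-incidences : ∀ {m} i (u : Q m) → lookup u i ≡ true → (i , u) ∈ incidences m
  ∈-incidences {suc m} i u uᵢ = subst (λ v → (i , v) ∈ incidences (suc m))
    (trans (cong (Vec.insertAt (Vec.removeAt u i) i) (sym uᵢ)) (insertAt-removeAt u i))
    (∈-cartesianProductWith⁺ _ (∈-allFin i) (∈-allQ (Vec.removeAt u i)))

  length-incidences : ∀ m → 2 * length (incidences m) ≡ m * 2 ^ m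
  length-incidences zero    = refl
  length-incidences (suc m) = begin
    2 * length (incidences (suc m))
      ≡⟨ cong (2 *_) (length-cartesianProductWith _ (allFin (suc m)) (allQ m)) ⟩
    2 * (length (allFin (suc m)) * length (allQ m))
      ≡⟨ cong (2 *_) (cong₂ _*_ (length-tabulate {n = suc m} (λ i → i)) (length-allQ m)) ⟩
    2 * (suc m * 2 ^ m)  ≡⟨ rearrange (suc m) (2 ^ m) ⟩
    suc m * (2 * 2 ^ m)  ∎
    where
    open ≡-Reasoning
    rearrange : ∀ x y → 2 * (x * y) ≡ x * (2 * y)
    rearrange = solve-∀

  module _ {m r n} (h : Fin m → Q r) (D : List (Q n)) where

    codewords : List (Q (m + (r + n)))
    codewords = cartesianProductWith (λ u w → u Vec.++ (syndrome h u Vec.++ w)) (allQ m) (allQ n)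

    -- Over each pair `(u , v)` that the graph of the syndrome may fail to cover, a copy of `D`
    -- covers the last factor.
    patches : List (Q (m + (r + n)))
    patches = cartesianProductWith (λ (i , u) c → u Vec.++ ((syndrome h u ⊕ h i) Vec.++ c))
      (incidences m) D

    -- If h i = syndrome u ⊕ v, raising bit i of u makes its syndrome v, unless that bit is already
    -- set; then v = syndrome u ⊕ h i, and it is w that is moved.
    refinement-covers : (∀ v → ∃[ i ] h i ≡ v) → DownwardCovers 1 D →
      DownwardCovers 1 (codewords ++ patches)
    refinement-covers h-surj cov y with Vec.splitAt m y
    ... | u , vw , refl with Vec.splitAt r vw
    ... | v , w , refl with h-surj (syndrome h u ⊕ v)
    ... | i , hᵢ with lookup u i in uᵢ
    ... | false = Any.++⁺ˡ (lose
      (∈-cartesianProductWith⁺ _ (∈-allQ (u [ i ]≔ true)) (∈-allQ w))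
      (B⁻-++ (raise-B⁻ u i)
        (subst (λ z → (v Vec.++ w) Unary.∈ B⁻ (z Vec.++ w) 0) (sym v≡) (x∈B⁻ (v Vec.++ w) 0))))
      where
      v≡ : syndrome h (u [ i ]≔ true) ≡ v
      v≡ = trans (syndrome-raise h u i uᵢ) (trans (cong (syndrome h u ⊕_) hᵢ) (⊕-cancelˡ _ v))
    ... | true = Any.++⁺ʳ codewords (Any.cartesianProductWith⁺ _
      (λ { refl c∋w → B⁻-++ (x∈B⁻ u 0)
        (B⁻-++ (subst (λ z → v Unary.∈ B⁻ z 0) (sym v≡) (x∈B⁻ v 0)) c∋w) })
      (∈-incidences i u uᵢ) (cov w))
      where
      v≡ : syndrome h u ⊕ h i ≡ v
      v≡ = trans (cong (syndrome h u ⊕_) hᵢ) (⊕-cancelˡ _ v)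

    -- Half of the `m * 2 ^ m` pairs of a coordinate and a vector carry a copy of `D`; the factor 2
    -- clears this half.
    length-refinement : 2 * length (codewords ++ patches) ≡
      2 ^ m * (2 * 2 ^ n + m * length D)
    length-refinement = begin
      2 * length (codewords ++ patches)
        ≡⟨ cong (2 *_) (length-++ codewords) ⟩
      2 * (length codewords + length patches)
        ≡⟨ cong (2 *_) (cong₂ _+_
             (trans (length-cartesianProductWith _ (allQ m) (allQ n))
                    (cong₂ _*_ (length-allQ m) (length-allQ n)))
             (length-cartesianProductWith _ (incidences m) D)) ⟩
      2 * (2 ^ m * 2 ^ n + length (incidences m) * length D)
        ≡⟨ rearrange (2 ^ m) (2 ^ n) (length (incidences m)) (length D) ⟩
      2 ^ m * (2 * 2 ^ n) + 2 * length (incidences m) * length D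
        ≡⟨ cong (λ z → 2 ^ m * (2 * 2 ^ n) + z * length D) (length-incidences m) ⟩
      2 ^ m * (2 * 2 ^ n) + m * 2 ^ m * length D
        ≡⟨ collect (2 ^ m) (2 * 2 ^ n) m _ ⟩
      2 ^ m * (2 * 2 ^ n + m * length D)  ∎
      where
      open ≡-Reasoning
      rearrange : ∀ x y z t → 2 * (x * y + z * t) ≡ x * (2 * y) + 2 * z * t
      rearrange = solve-∀
      collect : ∀ x y z t → x * y + z * x * t ≡ x * (y + z * t)
      collect = solve-∀

  -- This is the step from `κ` to `1/m + κ/2` with `m = 2 ^ r` and `κ = 2a / 2 ^ r`. The even
  -- numerator keeps the halving within the natural numbers.
  refine : ∀ {n a} r → Density≤ n 1 (2 * a) (2 ^ r) → Density≤ (2 ^ r + (r + n)) 1 (1 + a) (2 ^ r)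
  refine {n} {a} r (density D cov D≤) = subst (λ m → Density≤ (m + (r + n)) 1 (1 + a) (2 ^ r)) m≡
    (density (codewords h D ++ patches h D) (refinement-covers h D h-surj cov) (*-cancelˡ-≤ 2 (begin
      2 * (s * length (codewords h D ++ patches h D))  ≡⟨ swap 2 s _ ⟩
      s * (2 * length (codewords h D ++ patches h D))  ≡⟨ cong (s *_) (length-refinement h D) ⟩
      s * (2 ^ m * (2 * 2 ^ n + m * length D))
        ≡⟨ cong (λ z → s * (2 ^ m * (2 * 2 ^ n + z * length D))) m≡ ⟩
      s * (2 ^ m * (2 * 2 ^ n + s * length D))
        ≤⟨ *-monoʳ-≤ s (*-monoʳ-≤ (2 ^ m) (+-monoʳ-≤ (2 * 2 ^ n) D≤)) ⟩
      s * (2 ^ m * (2 * 2 ^ n + 2 * a * 2 ^ n))        ≡⟨ rearrange s (2 ^ m) (2 ^ n) a ⟩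
      2 * ((1 + a) * (2 ^ m * (s * 2 ^ n)))            ≡⟨ cong (λ z → 2 * ((1 + a) * z)) powers ⟨
      2 * ((1 + a) * 2 ^ (m + (r + n)))                ∎)))
    where
    open ≤-Reasoning
    s m : ℕ
    s = 2 ^ r
    -- There is one coordinate for each entry of `allQ r`, so that list lookup is the labelling;
    -- `m≡` identifies their number with `2 ^ r`.
    m = length (allQ r)
    m≡ : m ≡ s
    m≡ = length-allQ r
    h : Fin m → Q r
    h = List.lookup (allQ r)
    h-surj : ∀ v → ∃[ i ] h i ≡ v
    h-surj v = index (∈-allQ v) , sym (Any.lookup-index (∈-allQ v))
    powers : 2 ^ (m + (r + n)) ≡ 2 ^ m * (s * 2 ^ n)
    powers = trans (^-distribˡ-+-* 2 m (r + n)) (cong (2 ^ m *_) (^-distribˡ-+-* 2 r n))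
    swap : ∀ x y z → x * (y * z) ≡ y * (x * z)
    swap = solve-∀
    rearrange : ∀ s x y a → s * (x * (2 * y + 2 * a * y)) ≡ 2 * ((1 + a) * (x * (s * y)))
    rearrange = solve-∀

  r≤2^r : ∀ r → r ≤ 2 ^ r
  r≤2^r r = <⇒≤ (n<2^n r)
    where
    n<2^n : ∀ n → n < 2 ^ n
    n<2^n zero    = s≤s z≤n
    n<2^n (suc n) = ≤-trans (+-mono-≤ (≤-trans (s≤s z≤n) (n<2^n n)) (n<2^n n))
      (≤-reflexive (cong (2 ^ n +_) (sym (+-identityʳ (2 ^ n)))))

  -- Doubling the denominator turns the numerator 3 into 6, and refining twice brings it back
  -- through 4 to 3.
  radiusOne : ∀ r → ∃[ n ] n ≤ 8 * 2 ^ r × Density≤ n 1 3 (2 ^ r)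
  -- A single codeword covers the one-point cube: density 1, which is below 3.
  radiusOne zero = 0 , z≤n , density List.[ [] ] (λ { [] → here ([] , z≤n) }) (s≤s z≤n)
  radiusOne (suc r) with radiusOne r
  ... | n , n≤ , density C cov C≤ =
    2 ^ suc r + (suc r + (2 ^ suc r + (suc r + n))) , bound ,
    refine (suc r) (refine (suc r) (density C cov doubled))
    where
    open ≤-Reasoning
    doubled : 2 ^ suc r * length C ≤ 2 * 3 * 2 ^ n
    doubled = begin
      2 * 2 ^ r * length C    ≡⟨ *-assoc 2 (2 ^ r) _ ⟩
      2 * (2 ^ r * length C)  ≤⟨ *-monoʳ-≤ 2 C≤ ⟩
      2 * (3 * 2 ^ n)         ≡⟨ *-assoc 2 3 (2 ^ n) ⟨
      2 * 3 * 2 ^ n           ∎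
    -- With `x = 2 ^ r`, two refinements add at most `8 * x` coordinates, while the allowance grows
    -- from `8 * x` to `16 * x`; this fixes the constant 8.
    collect : ∀ x → 2 * x + (2 * x + (2 * x + (2 * x + 8 * x))) ≡ 8 * (2 * x)
    collect = solve-∀
    bound : 2 ^ suc r + (suc r + (2 ^ suc r + (suc r + n))) ≤ 8 * 2 ^ suc r
    bound = begin
      2 ^ suc r + (suc r + (2 ^ suc r + (suc r + n)))
        ≤⟨ +-monoʳ-≤ (2 ^ suc r) (+-mono-≤ (r≤2^r (suc r))
             (+-monoʳ-≤ (2 ^ suc r) (+-mono-≤ (r≤2^r (suc r)) n≤))) ⟩
      2 * 2 ^ r + (2 * 2 ^ r + (2 * 2 ^ r + (2 * 2 ^ r + 8 * 2 ^ r)))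
        ≡⟨ collect (2 ^ r) ⟩
      8 * 2 ^ suc r ∎

  -- Upper bound in every large dimension

  ^-distribʳ-* : ∀ m n k → (m * n) ^ k ≡ m ^ k * n ^ k
  ^-distribʳ-* m n zero    = refl
  ^-distribʳ-* m n (suc k) =
    trans (cong (m * n *_) (^-distribʳ-* m n k)) (*-interchange m n (m ^ k) (n ^ k))

  -- Induction on `n ∸ b`: the exponent grows by one exactly when `n` reaches the next value
  -- `b * 2 ^ suc r`.
  dyadicScale : ∀ b n → n ≥ b → .{{NonZero b}} → ∃[ r ] b * 2 ^ r ≤ n × n < b * 2 ^ suc r
  dyadicScale b n n≥b =
    subst (λ z → ∃[ r ] b * 2 ^ r ≤ z × z < b * 2 ^ suc r) (m∸n+n≡m n≥b) (go (n ∸ b))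
    where
    go : ∀ k → ∃[ r ] b * 2 ^ r ≤ k + b × k + b < b * 2 ^ suc r
    go zero    = 0 , ≤-reflexive (*-identityʳ b) , m<m*n b 2 (s≤s (s≤s z≤n))
    go (suc k) with go k
    ... | r , lo , hi with suc k + b <? b * 2 ^ suc r
    ...   | yes lt = r , m≤n⇒m≤1+n lo , lt
    ...   | no ¬lt = suc r , ≮⇒≥ ¬lt ,
      ≤-<-trans hi (*-monoʳ-< b (^-monoʳ-< 2 (s≤s (s≤s z≤n)) (n<1+n (suc r))))

  -- With `2 ^ r` of order `n / (R + 1)`, `R` blocks of dimension at most `8 * 2 ^ r` fit into `n`
  -- coordinates and the rest is padding. The density is at most `(3 / 2 ^ r) ^ R`, and
  -- `n ≤ 16 (R + 1) 2 ^ r` turns it into a multiple of `1 / n ^ R`. Using `suc R` keeps the scale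
  -- nonzero for `R = 0`.
  K⁺*n^R≤ : ∀ R n → n ≥ suc R * 8 → K⁺ n R * n ^ R ≤ (3 * (suc R * 16)) ^ R * 2 ^ n
  K⁺*n^R≤ R n n≥ with dyadicScale (suc R * 8) n n≥
  ... | r , lo , hi with radiusOne r
  ... | m , m≤ , D = begin
      K⁺ n R * n ^ R                            ≤⟨ *-monoʳ-≤ (K⁺ n R) (^-monoˡ-≤ R n≤) ⟩
      K⁺ n R * (suc R * 16 * 2 ^ r) ^ R         ≡⟨ cong (K⁺ n R *_) (^-distribʳ-* (suc R * 16) (2 ^ r) R) ⟩
      K⁺ n R * ((suc R * 16) ^ R * (2 ^ r) ^ R) ≡⟨ rearrange (K⁺ n R) ((suc R * 16) ^ R) ((2 ^ r) ^ R) ⟩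
      (suc R * 16) ^ R * ((2 ^ r) ^ R * K⁺ n R) ≤⟨ *-monoʳ-≤ ((suc R * 16) ^ R) K≤ ⟩
      (suc R * 16) ^ R * (3 ^ R * 2 ^ n)        ≡⟨ regroup ((suc R * 16) ^ R) (3 ^ R) (2 ^ n) ⟩
      3 ^ R * (suc R * 16) ^ R * 2 ^ n          ≡⟨ cong (_* 2 ^ n) (^-distribʳ-* 3 (suc R * 16) R) ⟨
      (3 * (suc R * 16)) ^ R * 2 ^ n            ∎
    where
    open ≤-Reasoning
    rearrange : ∀ x y z → x * (y * z) ≡ y * (z * x)
    rearrange = solve-∀
    regroup : ∀ x y z → x * (y * z) ≡ y * x * z
    regroup = solve-∀
    double : ∀ x y → x * 8 * (2 * y) ≡ x * 16 * y
    double = solve-∀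
    n≤ : n ≤ suc R * 16 * 2 ^ r
    n≤ = ≤-trans (<⇒≤ hi) (≤-reflexive (double (suc R) (2 ^ r)))
    R*m≤n : R * m ≤ n
    R*m≤n = begin
      R * m                ≤⟨ *-mono-≤ (n≤1+n R) m≤ ⟩
      suc R * (8 * 2 ^ r)  ≡⟨ *-assoc (suc R) 8 (2 ^ r) ⟨
      suc R * 8 * 2 ^ r    ≤⟨ lo ⟩
      n                    ∎
    K≤ : (2 ^ r) ^ R * K⁺ n R ≤ 3 ^ R * 2 ^ n
    -- The `n ∸ R * m` coordinates outside the blocks are padded with the full cube at radius 0.
    K≤ = K⁺≤ (subst₂ (λ a b → Density≤ n R a b) (*-identityˡ (3 ^ R)) (*-identityˡ ((2 ^ r) ^ R))
      (subst (λ k → Density≤ k R (1 * 3 ^ R) (1 * (2 ^ r) ^ R)) (m∸n+n≡m R*m≤n)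
        (directSum (trivialDensity (n ∸ R * m)) (directPower R D))))

-- From natural numbers to rational fractions

open import Data.Rational using (ℚ; 0ℚ; _<_; _≤_; _*_)

infixl 8 _÷_

_÷_ : (a b : ℕ) .{{_ : NonZero b}} → ℚ
a ÷ b = ℤ.+ a ℚ./ b

-- Rationals are kept in lowest terms. Unnormalised fractions retain `a` and `b`, so comparisons
-- there become cross-multiplications.
toℚᵘ-÷ : ∀ a b .{{_ : NonZero b}} → ℚ.toℚᵘ (a ÷ b) ℚᵘ.≃ ℤ.+ a ℚᵘ./ b
toℚᵘ-÷ a (suc b) = ℚ.toℚᵘ-fromℚᵘ (ℚᵘ.mkℚᵘ (ℤ.+ a) b)

÷-pos : ∀ a b .{{_ : NonZero a}} .{{_ : NonZero b}} → 0ℚ < a ÷ b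
÷-pos (suc a) (suc b) = ℚ.toℚᵘ-cancel-< (ℚᵘ.<-respʳ-≃ (ℚᵘ.≃-sym (toℚᵘ-÷ (suc a) (suc b)))
  (ℚᵘ.*<* (ℤ.+<+ (s≤s z≤n))))

÷-mono-≤ : ∀ a b p q .{{_ : NonZero b}} .{{_ : NonZero q}} → a ℕ.* q ℕ.≤ p ℕ.* b → a ÷ b ≤ p ÷ q
÷-mono-≤ a (suc b) p (suc q) le = ℚ.toℚᵘ-cancel-≤
  (ℚᵘ.≤-respˡ-≃ (ℚᵘ.≃-sym (toℚᵘ-÷ a (suc b)))
  (ℚᵘ.≤-respʳ-≃ (ℚᵘ.≃-sym (toℚᵘ-÷ p (suc q)))
  (ℚᵘ.*≤* (subst₂ ℤ._≤_ (ℤ.pos-* a (suc q)) (ℤ.pos-* p (suc b)) (ℤ.+≤+ le)))))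

÷-*-÷ : ∀ a b p q .{{_ : NonZero b}} .{{_ : NonZero q}} →
  a ÷ b * p ÷ q ≡ ((a ℕ.* p) ÷ (b ℕ.* q)) {{ℕ.m*n≢0 b q}}
÷-*-÷ a b@(suc b′) p q@(suc q′) = ℚ.toℚᵘ-injective (begin
  ℚ.toℚᵘ (a ÷ b * p ÷ q)              ≈⟨ ℚ.toℚᵘ-homo-* (a ÷ b) (p ÷ q) ⟩
  ℚ.toℚᵘ (a ÷ b) ℚᵘ.* ℚ.toℚᵘ (p ÷ q)  ≈⟨ ℚᵘ.*-cong (toℚᵘ-÷ a b) (toℚᵘ-÷ p q) ⟩
  (ℤ.+ a ℚᵘ./ b) ℚᵘ.* (ℤ.+ p ℚᵘ./ q)  ≡⟨ cong (ℚᵘ._/ (b ℕ.* q)) (ℤ.pos-* a p) ⟨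
  ℤ.+ (a ℕ.* p) ℚᵘ./ (b ℕ.* q)        ≈⟨ toℚᵘ-÷ (a ℕ.* p) (b ℕ.* q) ⟨
  ℚ.toℚᵘ ((a ℕ.* p) ÷ (b ℕ.* q))      ∎)
  where open ℚᵘ.≃-Reasoning

theorem9 : (R : ℕ) →
    ∃[ c ] ∃[ C ] ∃[ n₀ ] 0ℚ < c × 0ℚ < C ×
    (∀ n .{{_ : NonZero n}} → n ≥ n₀ →
    c * 2ⁿ/nᴿ n R ≤ fromℕ (K⁺ n R) ×
    fromℕ (K⁺ n R) ≤ C * 2ⁿ/nᴿ n R)
-- The lower constant pays for replacing `n + 1` by `2n` in the ball volume. In `A` the 3 is the
-- numerator of the radius-one density and `16 (R + 1)` bounds `n / 2 ^ r`; the threshold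
-- `8 (R + 1)` is the scale at `r = 0`.
theorem9 R = 1 ÷ (2 ^ R) , A ÷ 1 , suc R ℕ.* 8 , ÷-pos 1 (2 ^ R) , ÷-pos A 1 , λ n n≥ →
  lower n , upper n n≥
  where
  open ℕ.≤-Reasoning
  A : ℕ
  A = (3 ℕ.* (suc R ℕ.* 16)) ^ R
  instance
    2^R≢0 : NonZero (2 ^ R)
    2^R≢0 = ℕ.m^n≢0 2 R
    A≢0 : NonZero A
    A≢0 = ℕ.m^n≢0 (3 ℕ.* (suc R ℕ.* 16)) R

  lower : ∀ n .{{_ : NonZero n}} → 1 ÷ (2 ^ R) * 2ⁿ/nᴿ n R ≤ fromℕ (K⁺ n R)
  lower n@(suc n-1) = subst (_≤ fromℕ (K⁺ n R)) (sym (÷-*-÷ 1 (2 ^ R) (2 ^ n) (n ^ R)))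
    (÷-mono-≤ (1 ℕ.* 2 ^ n) (2 ^ R ℕ.* n ^ R) (K⁺ n R) 1 (begin
      1 ℕ.* 2 ^ n ℕ.* 1                ≡⟨ ℕ.*-identityʳ (1 ℕ.* 2 ^ n) ⟩
      1 ℕ.* 2 ^ n                      ≡⟨ ℕ.*-identityˡ (2 ^ n) ⟩
      2 ^ n                            ≤⟨ sphereCoveringBound n R ⟩
      K⁺ n R ℕ.* suc n ^ R             ≤⟨ ℕ.*-monoʳ-≤ (K⁺ n R) (ℕ.^-monoˡ-≤ R 1+n≤2n) ⟩
      K⁺ n R ℕ.* (2 ℕ.* n) ^ R         ≡⟨ cong (K⁺ n R ℕ.*_) (^-distribʳ-* 2 n R) ⟩
      K⁺ n R ℕ.* (2 ^ R ℕ.* n ^ R)     ∎))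
    where
    instance
      n^R≢0 : NonZero (n ^ R)
      n^R≢0 = ℕ.m^n≢0 n R
      denominator≢0 : NonZero (2 ^ R ℕ.* n ^ R)
      denominator≢0 = ℕ.m*n≢0 (2 ^ R) (n ^ R)
    1+n≤2n : suc n ℕ.≤ 2 ℕ.* n
    1+n≤2n = ℕ.+-mono-≤ (s≤s (z≤n {n-1})) (ℕ.m≤m+n n 0)

  upper : ∀ n .{{_ : NonZero n}} → n ≥ suc R ℕ.* 8 → fromℕ (K⁺ n R) ≤ A ÷ 1 * 2ⁿ/nᴿ n R
  upper n n≥ = subst (fromℕ (K⁺ n R) ≤_) (sym (÷-*-÷ A 1 (2 ^ n) (n ^ R)))
    (÷-mono-≤ (K⁺ n R) 1 (A ℕ.* 2 ^ n) (1 ℕ.* n ^ R) (begin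
      K⁺ n R ℕ.* (1 ℕ.* n ^ R)  ≡⟨ cong (K⁺ n R ℕ.*_) (ℕ.*-identityˡ (n ^ R)) ⟩
      K⁺ n R ℕ.* n ^ R          ≤⟨ K⁺*n^R≤ R n n≥ ⟩
      A ℕ.* 2 ^ n               ≡⟨ ℕ.*-identityʳ (A ℕ.* 2 ^ n) ⟨
      A ℕ.* 2 ^ n ℕ.* 1         ∎))
    where
    instance
      n^R≢0 : NonZero (n ^ R)
      n^R≢0 = ℕ.m^n≢0 n R
      denominator≢0 : NonZero (1 ℕ.* n ^ R)
      denominator≢0 = ℕ.m*n≢0 1 (n ^ R)
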